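{- If $T\subseteq\mathbb{Z}^n$ is an integer tiling with $\Upsilon_n$, where $n$ is even, then $n=3^t-1$ for some $t>0$.
   Context: $\Upsilon_n=\{U\in\mathbb{Z}^n:\sum_i|x_i-u_i|\le1\text{ for some }X\in\{ -1,0\}^n\}$. A set $T\subseteq\mathbb{Z}^n$ is an integer tiling with $\Upsilon_n$ if the translates $X+\Upsilon_n$, $X\in T$, partition $\mathbb{Z}^n$. -}

module Defs where

open import Data.Nat using (ℕ; zero; suc)
open import Data.Integer using (ℤ; +_; -[1+_]; _-_; _≤_; ∣_∣)
open import Data.Fin using (Fin) renaming (zero to fzero; suc to fsuc)
open import Data.Product using (Σ; _×_; ∃)
open import Data.Sum using (_⊎_)
open import Relation.Binary.PropositionalEquality using (_≡_)

Point : ℕ → Set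
Point n = Fin n → ℤ

ΣFin : (n : ℕ) → (Fin n → ℕ) → ℕ
ΣFin zero    f = 0
ΣFin (suc n) f = f fzero Data.Nat.+ ΣFin n (λ i → f (fsuc i))

dist₁ : {n : ℕ} → Point n → Point n → ℕ
dist₁ {n} x u = ΣFin n (λ i → ∣ x i - u i ∣)

IsBinaryNeg : {n : ℕ} → Point n → Set
IsBinaryNeg x = ∀ i → (x i ≡ -[1+ 0 ]) ⊎ (x i ≡ + 0)

Υ : (n : ℕ) → Point n → Set
Υ n u = Σ (Point n) λ x → IsBinaryNeg x × (dist₁ x u Data.Nat.≤ 1)

InTranslate : {n : ℕ} → Point n → Point n → Set
InTranslate {n} x z = Υ n (λ i → z i - x i)

IsTiling : (n : ℕ) → (Point n → Set) → Set
IsTiling n T =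
  (∀ (z : Point n) → Σ (Point n) λ x → T x × InTranslate x z)
  × (∀ (z x y : Point n) → T x → T y → InTranslate x z → InTranslate y z →
       ∀ i → x i ≡ y i)

{-# OPTIONS --safe #-}

-- Let S be the union of the cubes t + {-1,0}^n, t ∈ T.  Tiling by Υ means that a
-- cell outside S has exactly one neighbour in S, while a cell of S has exactly
-- one of its two neighbours along each axis in S.  Hence, if S is periodic with
-- period 12 along every axis, double counting on the torus gives
-- (n+1) |S| = 12^n, so for even n the odd number n+1 divides a power of 3.
--
-- For the periodicity, take a corner s of a cube, and let d_i be the signed unit
-- vectors pointing out of the cube at s.  For all x, y there is exactly one z
-- with s + d_x + d_y + d_z ∈ S; this makes the set of axes a totally symmetric
-- quasigroup.  The square y of x (s + 2d_x + d_y ∈ S) does not change when s moves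
-- to the neighbouring corner of the cube along an axis l: for l ≠ x this follows
-- locally, and for l = x by parity, since the number of x with a given square is
-- even when n is.  Going from s to the opposite corner at s + 2d_x + d_y and
-- crossing that cube along x, one gets s + 4d_x if y = x, and s + 6d_x after two
-- rounds if y ≠ x.
module Submission where

open import Defs
open import Data.Bool using (Bool; true; false; not; if_then_else_)
import Data.Bool.Properties as Bool
open import Data.Fin using (Fin; zero; suc; toℕ; _≟_)
import Data.Fin.Properties as Fin
open import Data.Integer as ℤ using (ℤ; -[1+_]; 0ℤ; 1ℤ; -1ℤ)
import Data.Integer.Properties as ℤ
open import Data.Integer.Solver using (module +-*-Solver)
open import Data.Nat using (ℕ; zero; suc; _+_; _≤_; z≤n; s≤s; _^_; _∸_; _<_; _*_)
open import Data.Nat.Coprimality using (Coprime; coprime-divisor)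
open import Data.Nat.Divisibility
  using (_∣_; divides; _∣?_; ∣m+n∣m⇒∣n; m∣m*n; ∣n⇒∣m*n; ∣1⇒≡1; *-cancelˡ-∣)
open import Data.Nat.Primality using (Irreducible; irreducible[2]; prime?; prime⇒irreducible)
import Data.Nat.Properties as ℕ
open import Data.Nat.Solver renaming (module +-*-Solver to ℕ-Solver)
open import Data.Product using (Σ; ∃; ∃₂; _×_; _,_; proj₁; proj₂)
open import Data.Sum using (_⊎_; inj₁; inj₂)
open import Data.Vec.Functional using (updateAt; replicate; _∷_)
open import Data.Vec.Functional.Properties using (updateAt-updates; updateAt-minimal)
open import Function using (_∘_)
open import Relation.Binary.PropositionalEquality hiding (resp)
open import Relation.Nullary using (¬_; does; Dec; yes; no; contradiction)
open import Relation.Nullary.Decidable using (from-yes; _⊎-dec_)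
open import Algebra.Properties.CommutativeMonoid.Sum ℕ.+-0-commutativeMonoid
  using (sum; sum-cong-≗; sum-replicate-zero; ∑-distrib-+)

open +-*-Solver using (solve; _:+_; _:*_; _:=_; :-_; con)

private variable
  n : ℕ

-- Signed unit vectors and orientations

infixl 6 _⊹_

_⊹_ : Point n → Point n → Point n
(z ⊹ u) k = z k ℤ.+ u k

sgn : Bool → ℤ
sgn true  = 1ℤ
sgn false = -1ℤ

ν : Fin n → Bool → Point n
ν i b = updateAt (replicate _ 0ℤ) i (λ _ → sgn b)

ν-not : ∀ (i : Fin n) b k → ν i (not b) k ≡ ℤ.- ν i b k
ν-not zero    true  zero    = refl
ν-not zero    false zero    = refl
ν-not zero    b     (suc k) = refl
ν-not (suc i) b     zero    = refl
ν-not (suc i) b     (suc k) = ν-not i b k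

cancel : ∀ z (i : Fin n) b → z ⊹ ν i b ⊹ ν i (not b) ≗ z
cancel z i b k rewrite ν-not i b k =
  solve 2 (λ z u → z :+ u :+ :- u := z) refl (z k) (ν i b k)

cancel′ : ∀ z (i : Fin n) b → z ⊹ ν i (not b) ⊹ ν i b ≗ z
cancel′ z i b k rewrite ν-not i b k =
  solve 2 (λ z u → z :+ :- u :+ u := z) refl (z k) (ν i b k)

swap₂ : ∀ (z u v : Point n) → z ⊹ u ⊹ v ≗ z ⊹ v ⊹ u
swap₂ z u v k = solve 3 (λ z u v → z :+ u :+ v := z :+ v :+ u) refl (z k) (u k) (v k)

swap₃ : ∀ (z u v w : Point n) → z ⊹ u ⊹ v ⊹ w ≗ z ⊹ w ⊹ u ⊹ v
swap₃ z u v w k =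
  solve 4 (λ z u v w → z :+ u :+ v :+ w := z :+ w :+ u :+ v) refl (z k) (u k) (v k) (w k)

⊹-congˡ : ∀ {z w : Point n} u → z ≗ w → z ⊹ u ≗ w ⊹ u
⊹-congˡ u z≗w k = cong (ℤ._+ u k) (z≗w k)

flip : Fin n → (Fin n → Bool) → Fin n → Bool
flip l o = updateAt o l not

flip-≡ : ∀ (l : Fin n) o → flip l o l ≡ not (o l)
flip-≡ l o = updateAt-updates l o

flip-≢ : ∀ {i l : Fin n} o → i ≢ l → flip l o i ≡ o i
flip-≢ {i = i} {l} o = updateAt-minimal i l o

-- Finite sums of natural numbers

sum-replace : ∀ {g h : Fin n → ℕ} i → (∀ j → j ≢ i → g j ≡ h j) → sum g + h i ≡ sum h + g i
sum-replace {g = g} {h} zero g≗h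
  rewrite sum-cong-≗ {x = g ∘ suc} {h ∘ suc} (λ j → g≗h (suc j) λ ()) =
  ℕ-Solver.solve 3 (λ a b s → a :+′ s :+′ b :=′ b :+′ s :+′ a) refl (g zero) (h zero) (sum (h ∘ suc))
  where open ℕ-Solver using () renaming (_:+_ to _:+′_; _:=_ to _:=′_)
sum-replace {g = g} {h} (suc i) g≗h
  rewrite g≗h zero (λ ()) | ℕ.+-assoc (h zero) (sum (g ∘ suc)) (h (suc i))
        | ℕ.+-assoc (h zero) (sum (h ∘ suc)) (g (suc i)) =
  cong (h zero +_) (sum-replace i λ j j≢i → g≗h (suc j) (j≢i ∘ Fin.suc-injective))

sum-single : ∀ (g : Fin n → ℕ) i → (∀ j → j ≢ i → g j ≡ 0) → sum g ≡ g i
sum-single {n} g i g≡0 =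
  trans (sym (ℕ.+-identityʳ _)) (trans (sum-replace {h = replicate n 0} i g≡0) (cong (_+ g i) (sum-replicate-zero n)))

sum-const : ∀ n c → sum (replicate n c) ≡ n * c
sum-const zero    c = refl
sum-const (suc n) c = cong (c +_) (sum-const n c)

-- Off-diagonal entries come in equal pairs, so `q` is the sum above the diagonal. The trace
-- therefore has the parity of the total.
sum-symmetric : ∀ (M : Fin n → Fin n → ℕ) → (∀ i j → M i j ≡ M j i) →
                ∃ λ q → sum (λ i → sum (M i)) ≡ 2 * q + sum (λ i → M i i)
sum-symmetric {zero}  M M-sym = 0 , refl
sum-symmetric {suc n} M M-sym with sum-symmetric (λ i j → M (suc i) (suc j)) (λ i j → M-sym (suc i) (suc j))
... | q , eq = r + q , (begin
  m + r + sum (λ i → M (suc i) zero + sum (λ j → M (suc i) (suc j)))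
    ≡⟨ cong (m + r +_) (∑-distrib-+ (λ i → M (suc i) zero) _) ⟩
  m + r + (sum (λ i → M (suc i) zero) + sum (λ i → sum (λ j → M (suc i) (suc j))))
    ≡⟨ cong₂ (λ a b → m + r + (a + b)) (sum-cong-≗ λ i → M-sym (suc i) zero) eq ⟩
  m + r + (r + (2 * q + t))
    ≡⟨ ℕ-Solver.solve 4 (λ m r q t → m :+′ r :+′ (r :+′ (con′ 2 :*′ q :+′ t)) :=′
                                     con′ 2 :*′ (r :+′ q) :+′ (m :+′ t)) refl m r q t ⟩
  2 * (r + q) + (m + t) ∎)
  where
  open ≡-Reasoning
  open ℕ-Solver using () renaming (_:+_ to _:+′_; _:=_ to _:=′_; _:*_ to _:*′_; con to con′)
  m = M zero zero
  r = sum (λ j → M zero (suc j))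
  t = sum (λ i → M (suc i) (suc i))

-- Neighbour conditions on a set of cells

-- What the geometric argument keeps of the tiling: the individual cubes are forgotten, and only the
-- neighbour counts of their union remain. Membership is decidable so that cells can be counted.
record Dominating (S : Point n → Set) : Set where
  field
    resp      : ∀ {z w} → z ≗ w → S z → S w
    S?        : ∀ z → Dec (S z)
    dominated : ∀ z → ¬ S z → ∃₂ λ i b → S (z ⊹ ν i b)
    once      : ∀ z {i j a b} → ¬ S z → S (z ⊹ ν i a) → S (z ⊹ ν j b) → i ≡ j × a ≡ b
    paired    : ∀ z i → S z → ∃ λ b → S (z ⊹ ν i b) × ¬ S (z ⊹ ν i (not b))

-- The quasigroup at a corner

module Corners {S : Point n → Set} (D : Dominating S) where
  open Dominating D

  once-axis : ∀ z {i j a b} → ¬ S z → S (z ⊹ ν i a) → S (z ⊹ ν j b) → i ≡ j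
  once-axis z z∉S p q = proj₁ (once z z∉S p q)

  -- o i is the sign of the direction leaving the cube at its corner s along axis i.
  record Corner (s : Point n) (o : Fin n → Bool) : Set where
    field
      inside  : S s
      outward : ∀ i → ¬ S (s ⊹ ν i (o i))

  open Corner

  Corner-resp : ∀ {s t o p} → s ≗ t → o ≗ p → Corner s o → Corner t p
  Corner-resp s≗t o≗p c .inside = resp s≗t (inside c)
  Corner-resp s≗t o≗p c .outward i h = outward c i
    (resp (λ k → cong₂ ℤ._+_ (sym (s≗t k)) (cong (λ b → ν i b k) (sym (o≗p i)))) h)

  -- In the quasigroup of the corner (s , o): x · y = z.
  Tri : Point n → (Fin n → Bool) → Fin n → Fin n → Fin n → Set
  Tri s o x y z = S (s ⊹ ν x (o x) ⊹ ν y (o y) ⊹ ν z (o z))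

  Tri-resp : ∀ {s t o p x y z} → s ≗ t → o ≗ p → Tri s o x y z → Tri t p x y z
  Tri-resp {x = x} {y} {z} s≗t o≗p = resp λ k →
    cong₂ ℤ._+_ (cong₂ ℤ._+_ (cong₂ ℤ._+_ (s≗t k) (ν-cong x k)) (ν-cong y k)) (ν-cong z k)
    where ν-cong = λ i k → cong (λ b → ν i b k) (o≗p i)

  -- Cubes have side two, so each of their cells is a corner: `paired` gives the inward sign on
  -- every axis.
  corner-at : ∀ {s} → S s → ∃ (Corner s)
  corner-at {s} h = (λ i → not (proj₁ (paired s i h))) , record
    { inside = h ; outward = λ i → proj₂ (proj₂ (paired s i h)) }

  other-side : ∀ z i b → S z → ¬ S (z ⊹ ν i b) → S (z ⊹ ν i (not b))
  other-side z i b z∈S z+∉S with paired z i z∈S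
  ... | a , h , _ with a Bool.≟ b
  ... | yes refl = contradiction h z+∉S
  ... | no a≢b   = subst (λ b → S (z ⊹ ν i b)) (Bool.¬-not a≢b) h

  one-side : ∀ z i b → S z → S (z ⊹ ν i b) → ¬ S (z ⊹ ν i (not b))
  one-side z i b z∈S z+∈S z-∈S with paired z i z∈S
  ... | a , _ , h with a Bool.≟ b
  ... | yes refl = h z-∈S
  ... | no a≢b   = h (subst (λ b → S (z ⊹ ν i b)) (sym (trans (cong not (Bool.¬-not a≢b)) (Bool.not-involutive b))) z+∈S)

  module _ {s o} (c : Corner s o) where
    private
      d : Fin n → Point n
      d i = ν i (o i)

    inward : ∀ i → S (s ⊹ ν i (not (o i)))
    inward i = other-side s i (o i) (inside c) (outward c i)

    -- The cell s + d_x lies outside `S` and already has its only neighbour in `S`, namely s; d_y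
    -- never points back to s.
    level₂ : ∀ x y → ¬ S (s ⊹ d x ⊹ d y)
    level₂ x y h
      with refl , e ← once (s ⊹ d x) (outward c x) (resp (sym ∘ cancel s x (o x)) (inside c)) h
      = Bool.not-¬ refl (sym e)

    -- For i ≠ l, a cell of `S` just outside the new corner along i would be a second neighbour in
    -- `S` of s + d_i, besides s.
    flip-corner : ∀ l → Corner (s ⊹ ν l (not (o l))) (flip l o)
    flip-corner l .inside = inward l
    flip-corner l .outward i h with i ≟ l
    ... | yes refl rewrite flip-≡ l o =
          one-side _ l (o l) (inward l) (resp (sym ∘ cancel′ s l (o l)) (inside c)) h
    ... | no i≢l rewrite flip-≢ o i≢l =
          i≢l (once-axis _ (outward c i) (resp (sym ∘ cancel s i (o i)) (inside c))
                                         (resp (swap₂ s _ (d i)) h))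

  module _ {s o} (c : Corner s o) where
    private
      d : Fin n → Point n
      d i = ν i (o i)

    -- The cell s + d_x + d_y is outside `S`, so it has a neighbour in `S`; what has to be excluded
    -- is a neighbour in an inward direction -d_z.
    product : ∀ x y → ∃ (Tri s o x y)
    product x y with dominated _ (level₂ c x y)
    ... | z , b , h with b Bool.≟ o z
    ... | yes refl = z , h
    ... | no b≢o with Bool.¬-not b≢o
    ... | refl with z ≟ x | z ≟ y
    ... | yes refl | _        = contradiction
          (resp (λ k → trans (⊹-congˡ (ν z (not (o z))) (swap₂ s (d z) (d y)) k)
                             (cancel (s ⊹ d y) z (o z) k)) h)
          (outward c y)
    ... | no _     | yes refl = contradiction (resp (cancel (s ⊹ d x) z (o z)) h) (outward c x)
    -- Seen from the neighbouring corner s - d_z, this cell is again two outward steps away.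
    ... | no z≢x   | no z≢y   = contradiction
          (resp (swap₃ s (d x) (d y) _) h)
          (subst₂ (λ a b → ¬ S (s ⊹ ν z (not (o z)) ⊹ ν x a ⊹ ν y b))
            (flip-≢ o (z≢x ∘ sym)) (flip-≢ o (z≢y ∘ sym)) (level₂ (flip-corner c z) x y))

    product-unique : ∀ {x y z z′} → Tri s o x y z → Tri s o x y z′ → z ≡ z′
    product-unique {x} {y} = once-axis _ (level₂ c x y)

    -- Along x, the neighbour of s + d_x + d_y + d_z on the inner side is s + d_y + d_z, which
    -- `level₂` excludes; so the outer one lies in `S`.
    extend : ∀ {x y z} → Tri s o x y z → S (s ⊹ d x ⊹ d y ⊹ d z ⊹ d x)
    extend {x} {y} {z} h = subst (λ b → S (s ⊹ d x ⊹ d y ⊹ d z ⊹ ν x b)) (Bool.not-involutive (o x))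
      (other-side _ x (not (o x)) h (level₂ c y z ∘ resp back))
      where
      back : s ⊹ d x ⊹ d y ⊹ d z ⊹ ν x (not (o x)) ≗ s ⊹ d y ⊹ d z
      back k rewrite ν-not x (o x) k =
        solve 4 (λ s x y z → s :+ x :+ y :+ z :+ :- x := s :+ y :+ z) refl (s k) (d x k) (d y k) (d z k)

    -- The cube reached at s + 2d_x + d_y

    module _ {x y} (xxy : Tri s o x x y) where

      -- With z the product of x and l, a counterexample would leave
      -- s + 2d_x + d_l ∉ S with the two neighbours in directions d_y and d_z.
      sharp : ∀ {l} → l ≢ x → l ≢ y → ¬ S (s ⊹ d x ⊹ d x ⊹ d y ⊹ d l)
      sharp {l} l≢x l≢y h with z , xlz ← product x l = l≢x (once-axis _ (level₂ c x y)
          (resp (λ k → swap₂ (s ⊹ d x) (d l) (d y) k) (subst (Tri s o x l) (sym y≡z) xlz))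
          (resp (swap₂ (s ⊹ d x) (d x) (d y)) xxy))
        where
        xxl∉S : ¬ Tri s o x x l
        xxl∉S xxl = l≢y (product-unique xxl xxy)
        y≡z : y ≡ z
        y≡z = once-axis _ xxl∉S
          (resp (swap₂ (s ⊹ d x ⊹ d x) (d y) (d l)) h)
          (resp (λ k → solve 4 (λ s x l z → s :+ x :+ l :+ z :+ x := s :+ x :+ x :+ l :+ z) refl
                         (s k) (d x k) (d l k) (d z k))
            (extend xlz))

      sharp-inward : ∀ {l} → l ≢ x → l ≢ y → S (s ⊹ d x ⊹ d x ⊹ d y ⊹ ν l (not (o l)))
      sharp-inward {l} l≢x l≢y = other-side _ l (o l) xxy (sharp l≢x l≢y)

      -- Stepping back along x or y gives a cell excluded by `level₂`; the other axes are covered by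
      -- `sharp`. Describing `p` pointwise lets x = y and x ≠ y share one statement.
      opposite-corner : ∀ {p} → (∀ i → i ≡ x ⊎ i ≡ y → p i ≡ not (o i)) →
                        (∀ i → i ≢ x → i ≢ y → p i ≡ o i) → Corner (s ⊹ d x ⊹ d x ⊹ d y) p
      opposite-corner turned kept .inside = xxy
      opposite-corner turned kept .outward i h with i ≟ x | i ≟ y
      ... | no i≢x   | no i≢y rewrite kept i i≢x i≢y = sharp i≢x i≢y h
      ... | _        | yes refl rewrite turned i (inj₂ refl) =
            level₂ c x x (resp (cancel (s ⊹ d x ⊹ d x) i (o i)) h)
      ... | yes refl | no _ rewrite turned i (inj₁ refl) = level₂ c i y (resp
            (λ k → trans (⊹-congˡ (ν i (not (o i))) (swap₂ (s ⊹ d i) (d i) (d y)) k)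
                         (cancel (s ⊹ d i ⊹ d y) i (o i) k)) h)

  -- If l = y, a square z ≠ l at the new corner would, by `sharp-inward` there,
  -- also be the square at the old one.
  stable : ∀ {s o x y l} → Corner s o → Tri s o x x y → l ≢ x →
           Tri (s ⊹ ν l (not (o l))) (flip l o) x x y
  stable {s} {o} {x} {y} {l} c xxy l≢x with l ≟ y
  ... | no l≢y = resp eq (sharp-inward c xxy l≢x l≢y)
    where
    eq : s ⊹ ν x (o x) ⊹ ν x (o x) ⊹ ν y (o y) ⊹ ν l (not (o l)) ≗
         s ⊹ ν l (not (o l)) ⊹ ν x (flip l o x) ⊹ ν x (flip l o x) ⊹ ν y (flip l o y)
    eq k rewrite flip-≢ o (l≢x ∘ sym) | flip-≢ o (l≢y ∘ sym) =
      solve 4 (λ s x y l → s :+ x :+ x :+ y :+ l := s :+ l :+ x :+ x :+ y) refl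
        (s k) (ν x (o x) k) (ν y (o y) k) (ν l (not (o l)) k)
  ... | yes refl with product (flip-corner c l) x x
  ... | z , xxz with z ≟ l
  ... | yes refl = xxz
  ... | no z≢l = contradiction (product-unique c
          (resp eq (sharp-inward (flip-corner c l) xxz l≢x (z≢l ∘ sym))) xxy) z≢l
    where
    eq : s ⊹ ν l (not (o l)) ⊹ ν x (flip l o x) ⊹ ν x (flip l o x) ⊹ ν z (flip l o z)
           ⊹ ν l (not (flip l o l)) ≗
         s ⊹ ν x (o x) ⊹ ν x (o x) ⊹ ν z (o z)
    eq k rewrite flip-≢ o (l≢x ∘ sym) | flip-≢ o z≢l | flip-≡ l o | Bool.not-involutive (o l)
               | ν-not l (o l) k =
      solve 4 (λ s x z l → s :+ :- l :+ x :+ x :+ z :+ l := s :+ x :+ x :+ z) refl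
        (s k) (ν x (o x) k) (ν z (o z) k) (ν l (o l) k)

  -- Counting square roots

  χ : Point n → ℕ
  χ z = if does (S? z) then 1 else 0

  χ-∈ : ∀ {z} → S z → χ z ≡ 1
  χ-∈ {z} h with S? z
  ... | yes _ = refl
  ... | no ¬h = contradiction h ¬h

  χ-∉ : ∀ {z} → ¬ S z → χ z ≡ 0
  χ-∉ {z} ¬h with S? z
  ... | yes h = contradiction h ¬h
  ... | no _  = refl

  χ-cong : ∀ {z w} → (S z → S w) → (S w → S z) → χ z ≡ χ w
  χ-cong {z} {w} f g with S? z
  ... | yes h = sym (χ-∈ (f h))
  ... | no ¬h = sym (χ-∉ (¬h ∘ g))

  module _ (2∣n : 2 ∣ n) where

    -- The matrix [j · k = y] is symmetric with row sums 1, so its trace has the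
    -- parity of n.
    square-roots-even : ∀ {s o} → Corner s o → ∀ y →
      2 ∣ sum (λ j → χ (s ⊹ ν j (o j) ⊹ ν j (o j) ⊹ ν y (o y)))
    square-roots-even {s} {o} c y
      with q , eq ← sum-symmetric (λ j k → χ (s ⊹ ν j (o j) ⊹ ν k (o k) ⊹ ν y (o y)))
             (λ j k → χ-cong
               (resp (⊹-congˡ (ν y (o y)) (swap₂ s (ν j (o j)) (ν k (o k)))))
               (resp (⊹-congˡ (ν y (o y)) (swap₂ s (ν k (o k)) (ν j (o j))))))
      = ∣m+n∣m⇒∣n (subst (2 ∣_) (trans (sym row-sums) eq) 2∣n) (m∣m*n q)
      where
      row : ∀ j → sum (λ k → χ (s ⊹ ν j (o j) ⊹ ν k (o k) ⊹ ν y (o y))) ≡ 1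
      row j with k , jyk ← product c j y =
        trans (sum-single _ k λ i i≢k → χ-∉ λ jiy → i≢k (product-unique c
                (resp (swap₂ (s ⊹ ν j (o j)) (ν i (o i)) (ν y (o y))) jiy) jyk))
              (χ-∈ (resp (swap₂ (s ⊹ ν j (o j)) (ν y (o y)) (ν k (o k))) jyk))
      row-sums : sum (λ j → sum (λ k → χ (s ⊹ ν j (o j) ⊹ ν k (o k) ⊹ ν y (o y)))) ≡ n
      row-sums = trans (sum-cong-≗ row) (trans (sum-const n 1) (ℕ.*-identityʳ n))

    -- For l = x, `stable` makes the square roots of y at the two corners agree except possibly at
    -- x. Both counts are even, so they cannot differ by this one root.
    stable-all : ∀ {s o x y} → Corner s o → Tri s o x x y → ∀ l →
                 Tri (s ⊹ ν l (not (o l))) (flip l o) x x y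
    stable-all {s} {o} {x} {y} c xxy l with l ≟ x
    ... | no l≢x = stable c xxy l≢x
    ... | yes refl with S? (s ⊹ ν l (not (o l)) ⊹ ν x (flip l o x) ⊹ ν x (flip l o x) ⊹ ν y (flip l o y))
    ... | yes h = h
    ... | no ¬h = contradiction (∣m+n∣m⇒∣n (subst (2 ∣_) eq (square-roots-even c y)) (square-roots-even c′ y)) λ
            { (divides 0 ()) ; (divides (suc _) ()) }
      where
      c′ = flip-corner c l
      roots roots′ : Fin n → ℕ
      roots  j = χ (s ⊹ ν j (o j) ⊹ ν j (o j) ⊹ ν y (o y))
      roots′ j = χ (s ⊹ ν l (not (o l)) ⊹ ν j (flip l o j) ⊹ ν j (flip l o j) ⊹ ν y (flip l o y))
      agree : ∀ j → j ≢ x → roots j ≡ roots′ j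
      agree j j≢x = χ-cong (λ jjy → stable c jjy (j≢x ∘ sym)) back
        where
        back : Tri (s ⊹ ν l (not (o l))) (flip l o) j j y → Tri s o j j y
        -- The square of j at s persists at the new corner, where uniqueness identifies it with y.
        back jjy with z , jjz ← product c j j =
          subst (Tri s o j j) (product-unique c′ (stable c jjz (j≢x ∘ sym)) jjy) jjz
      eq : sum roots ≡ sum roots′ + 1
      eq = trans (sym (ℕ.+-identityʳ _)) (trans (cong (sum roots +_) (sym (χ-∉ ¬h)))
             (trans (sum-replace x agree) (cong (sum roots′ +_) (χ-∈ xxy))))

    -- Periodicity along the axes

    -- From the opposite corner, two steps along x and one along y lead back to s, so the square of
    -- x there is again y. Crossing the cube along x keeps it by `stable-all`, which allows the move
    -- to be repeated.
    advance : ∀ {s o x y p} → Corner s o → Tri s o x x y →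
      (∀ i → i ≡ x ⊎ i ≡ y → p i ≡ not (o i)) → (∀ i → i ≢ x → i ≢ y → p i ≡ o i) →
      Corner (s ⊹ ν x (o x) ⊹ ν x (o x) ⊹ ν y (o y) ⊹ ν x (not (p x))) (flip x p) ×
      Tri    (s ⊹ ν x (o x) ⊹ ν x (o x) ⊹ ν y (o y) ⊹ ν x (not (p x))) (flip x p) x x y
    advance {s} {o} {x} {y} {p} c xxy turned kept =
      flip-corner c₁ x , stable-all c₁ (resp home (inside c)) x
      where
      c₁ = opposite-corner c xxy turned kept
      home : s ≗ s ⊹ ν x (o x) ⊹ ν x (o x) ⊹ ν y (o y) ⊹ ν x (p x) ⊹ ν x (p x) ⊹ ν y (p y)
      home k rewrite turned x (inj₁ refl) | turned y (inj₂ refl) | ν-not x (o x) k | ν-not y (o y) k =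
        solve 3 (λ s x y → s := s :+ x :+ x :+ y :+ :- x :+ :- x :+ :- y) refl
          (s k) (ν x (o x) k) (ν y (o y) k)

    advance-axis : ∀ {s o x} → Corner s o → Tri s o x x x →
      let t = s ⊹ ν x (o x) ⊹ ν x (o x) ⊹ ν x (o x) ⊹ ν x (o x) in Corner t o × Tri t o x x x
    advance-axis {s} {o} {x} c xxx
      with c₁ , xxx₁ ← advance {p = flip x o} c xxx
             (λ { i (inj₁ refl) → flip-≡ i o ; i (inj₂ refl) → flip-≡ i o }) (λ i i≢x _ → flip-≢ o i≢x)
      = Corner-resp pos ori c₁ , Tri-resp pos ori xxx₁
      where
      pos : s ⊹ ν x (o x) ⊹ ν x (o x) ⊹ ν x (o x) ⊹ ν x (not (flip x o x)) ≗
            s ⊹ ν x (o x) ⊹ ν x (o x) ⊹ ν x (o x) ⊹ ν x (o x)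
      pos k rewrite flip-≡ x o | Bool.not-involutive (o x) = refl
      ori : flip x (flip x o) ≗ o
      ori i with i ≟ x
      ... | yes refl = trans (flip-≡ x _) (trans (cong not (flip-≡ x o)) (Bool.not-involutive (o x)))
      ... | no i≢x   = trans (flip-≢ _ i≢x) (flip-≢ o i≢x)

    -- Axis x is turned twice and y once, so only the sign at y changes. Leaving `p` free up to
    -- pointwise equality lets a second round end at the original orientation itself.
    advance-pair : ∀ {s o x y p} → x ≢ y → Corner s o → Tri s o x x y →
      p y ≡ not (o y) → (∀ i → i ≢ y → p i ≡ o i) →
      let t = s ⊹ ν x (o x) ⊹ ν x (o x) ⊹ ν y (o y) ⊹ ν x (o x) in Corner t p × Tri t p x x y
    advance-pair {s} {o} {x} {y} {p} x≢y c xxy py p≗o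
      with c₁ , xxy₁ ← advance {p = flip x p} c xxy
             (λ { i (inj₁ refl) → trans (flip-≡ i p) (cong not (p≗o i x≢y))
                ; i (inj₂ refl) → trans (flip-≢ p (x≢y ∘ sym)) py })
             (λ i i≢x i≢y → trans (flip-≢ p i≢x) (p≗o i i≢y))
      = Corner-resp pos ori c₁ , Tri-resp pos ori xxy₁
      where
      pos : s ⊹ ν x (o x) ⊹ ν x (o x) ⊹ ν y (o y) ⊹ ν x (not (flip x p x)) ≗
            s ⊹ ν x (o x) ⊹ ν x (o x) ⊹ ν y (o y) ⊹ ν x (o x)
      pos k rewrite flip-≡ x p | p≗o x x≢y | Bool.not-involutive (o x) = refl
      ori : flip x (flip x p) ≗ p
      ori i with i ≟ x
      ... | yes refl = trans (flip-≡ x _) (trans (cong not (flip-≡ x p)) (Bool.not-involutive (p x)))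
      ... | no i≢x   = trans (flip-≢ _ i≢x) (flip-≢ p i≢x)

    -- The two rounds move by 3d_x + d_y and 3d_x - d_y, as the first one reverses the sign at y.
    six-steps : ∀ {s o x y} → x ≢ y → Corner s o → Tri s o x x y →
      ∃ λ t → (∀ k → t k ≡ s k ℤ.+ ℤ.+ 6 ℤ.* ν x (o x) k) × Corner t o × Tri t o x x y
    six-steps {s} {o} {x} {y} x≢y c xxy
      with c₁ , xxy₁ ← advance-pair {p = flip y o} x≢y c xxy (flip-≡ y o) (λ i → flip-≢ o)
      = _ , pos , advance-pair x≢y c₁ xxy₁
                    (sym (trans (cong not (flip-≡ y o)) (Bool.not-involutive (o y))))
                    (λ i i≢y → sym (flip-≢ o i≢y))
      where
      pos : ∀ k → (s ⊹ ν x (o x) ⊹ ν x (o x) ⊹ ν y (o y) ⊹ ν x (o x)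
                     ⊹ ν x (flip y o x) ⊹ ν x (flip y o x) ⊹ ν y (flip y o y) ⊹ ν x (flip y o x)) k
                  ≡ s k ℤ.+ ℤ.+ 6 ℤ.* ν x (o x) k
      pos k rewrite flip-≢ o x≢y | flip-≡ y o | ν-not y (o y) k =
        solve 3 (λ s x y → s :+ x :+ x :+ y :+ x :+ x :+ x :+ :- y :+ x := s :+ con (ℤ.+ 6) :* x) refl
          (s k) (ν x (o x) k) (ν y (o y) k)

    -- Which case occurs depends on the corner and the axis; 12 is the least common multiple of the
    -- two step lengths 4 and 6.
    twelve-steps : ∀ {s o} → Corner s o → ∀ x → Corner (λ k → s k ℤ.+ ℤ.+ 12 ℤ.* ν x (o x) k) o
    twelve-steps {s} {o} c x with product c x x
    ... | y , xxy with x ≟ y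
    ... | no x≢y
        with t , t≗ , c₁ , xxy₁ ← six-steps x≢y c xxy
        with u , u≗ , c₂ , _ ← six-steps x≢y c₁ xxy₁
        = Corner-resp (λ k → trans (u≗ k) (trans (cong (ℤ._+ _) (t≗ k))
            (solve 2 (λ s x → s :+ con (ℤ.+ 6) :* x :+ con (ℤ.+ 6) :* x := s :+ con (ℤ.+ 12) :* x) refl
              (s k) (ν x (o x) k)))) (λ _ → refl) c₂
    ... | yes refl
        with c₁ , xxx₁ ← advance-axis c xxy
        with c₂ , xxx₂ ← advance-axis c₁ xxx₁
        with c₃ , _ ← advance-axis c₂ xxx₂
        = Corner-resp (λ k → solve 2 (λ s x → s :+ x :+ x :+ x :+ x :+ x :+ x :+ x :+ x :+ x :+ x :+ x :+ x
              := s :+ con (ℤ.+ 12) :* x) refl (s k) (ν x (o x) k)) (λ _ → refl) c₃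

    -- A corner advances in its outward direction only. For the other sign, go to the neighbouring
    -- corner along x, where that sign is outward, advance, and step back.
    periodic : ∀ {z} x b → S z → S (λ k → z k ℤ.+ ℤ.+ 12 ℤ.* ν x b k)
    periodic {z} x b z∈S with o , c ← corner-at z∈S with b Bool.≟ o x
    ... | yes refl = inside (twelve-steps c x)
    ... | no b≢ox with refl ← Bool.¬-not b≢ox =
          resp back (inward (twelve-steps (flip-corner c x) x) x)
      where
      back : (λ k → (z ⊹ ν x (not (o x))) k ℤ.+ ℤ.+ 12 ℤ.* ν x (flip x o x) k) ⊹ ν x (not (flip x o x)) ≗
             (λ k → z k ℤ.+ ℤ.+ 12 ℤ.* ν x (not (o x)) k)
      back k rewrite flip-≡ x o | ν-not x (not (o x)) k =
        solve 2 (λ z x → z :+ x :+ con (ℤ.+ 12) :* x :+ :- x := z :+ con (ℤ.+ 12) :* x) refl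
          (z k) (ν x (not (o x)) k)

-- Sums of periodic functions over a box

-- The box with coordinates 0 to m - 1 represents the torus of side m without forming a quotient.
boxΣ : ℕ → ∀ n → (Point n → ℕ) → ℕ
boxΣ m zero    F = F (λ ())
boxΣ m (suc n) F = sum {m} λ a → boxΣ m n λ v → F (ℤ.+ toℕ a ∷ v)

module _ (m : ℕ) where

  boxΣ-cong : ∀ n {F G : Point n → ℕ} → (∀ z → F z ≡ G z) → boxΣ m n F ≡ boxΣ m n G
  boxΣ-cong zero    F≗G = F≗G _
  boxΣ-cong (suc n) F≗G = sum-cong-≗ {m} λ a → boxΣ-cong n λ v → F≗G _

  boxΣ-+ : ∀ n (F G : Point n → ℕ) → boxΣ m n (λ z → F z + G z) ≡ boxΣ m n F + boxΣ m n G
  boxΣ-+ zero    F G = refl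
  boxΣ-+ (suc n) F G = trans (sum-cong-≗ {m} λ a → boxΣ-+ n _ _) (∑-distrib-+ {m} _ _)

  boxΣ-sum : ∀ n k (G : Fin k → Point n → ℕ) →
             boxΣ m n (λ z → sum λ i → G i z) ≡ sum λ i → boxΣ m n (G i)
  boxΣ-sum n zero    G = boxΣ-0 n
    where
    boxΣ-0 : ∀ n → boxΣ m n (λ _ → 0) ≡ 0
    boxΣ-0 zero    = refl
    boxΣ-0 (suc n) = trans (sum-cong-≗ {m} λ a → boxΣ-0 n) (sum-replicate-zero m)
  boxΣ-sum n (suc k) G = trans (boxΣ-+ n _ _) (cong (boxΣ m n (G zero) +_) (boxΣ-sum n k (G ∘ suc)))

  boxΣ-1 : ∀ n → boxΣ m n (λ _ → 1) ≡ m ^ n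
  boxΣ-1 zero    = refl
  boxΣ-1 (suc n) = trans (sum-cong-≗ {m} λ a → boxΣ-1 n) (sum-const m (m ^ n))

sum-telescope : ∀ m (H : ℕ → ℕ) →
  sum {m} (λ a → H (suc (toℕ a))) + H 0 ≡ sum {m} (λ a → H (toℕ a)) + H m
sum-telescope zero    H = refl
sum-telescope (suc m) H = begin
  H 1 + A + H 0   ≡⟨ cong (_+ H 0) (ℕ.+-comm (H 1) A) ⟩
  A + H 1 + H 0   ≡⟨ cong (_+ H 0) (sum-telescope m (H ∘ suc)) ⟩
  B + H (suc m) + H 0 ≡⟨ ℕ.+-comm _ (H 0) ⟩
  H 0 + (B + H (suc m)) ≡⟨ ℕ.+-assoc (H 0) B _ ⟨
  H 0 + B + H (suc m) ∎
  where
  open ≡-Reasoning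
  A = sum {m} (λ a → H (suc (suc (toℕ a))))
  B = sum {m} (λ a → H (suc (toℕ a)))

record Periodic (m : ℕ) (F : Point n → ℕ) : Set where
  field
    cong-≗ : ∀ z w → z ≗ w → F z ≡ F w
    period : ∀ i z → F (λ k → z k ℤ.+ ℤ.+ m ℤ.* ν i true k) ≡ F z

open Periodic

-- A shift along the first axis moves each slice to the next, and by periodicity slice m equals
-- slice 0. Along a later axis the shift acts within each slice.
boxΣ-shift⁺ : ∀ {m} {F : Point n → ℕ} → Periodic m F → ∀ i →
              boxΣ m n (λ z → F (z ⊹ ν i true)) ≡ boxΣ m n F
boxΣ-shift⁺ {suc n} {m} {F} P zero = begin
  sum {m} (λ a → boxΣ m n λ v → F ((ℤ.+ toℕ a ∷ v) ⊹ ν zero true))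
    ≡⟨ sum-cong-≗ {m} (λ a → boxΣ-cong m n λ v → cong-≗ P _ _ λ
         { zero → cong ℤ.+_ (ℕ.+-comm (toℕ a) 1) ; (suc k) → ℤ.+-identityʳ (v k) }) ⟩
  sum {m} (λ a → H (suc (toℕ a)))
    ≡⟨ ℕ.+-cancelʳ-≡ (H 0) _ _ (trans (sum-telescope m H) (cong (sum {m} (λ a → H (toℕ a)) +_) Hm≡H0)) ⟩
  sum {m} (λ a → H (toℕ a)) ∎
  where
  open ≡-Reasoning
  H : ℕ → ℕ
  H a = boxΣ m n λ v → F (ℤ.+ a ∷ v)
  Hm≡H0 : H m ≡ H 0
  Hm≡H0 = boxΣ-cong m n λ v → trans
    (cong-≗ P _ _ λ { zero    → sym (trans (ℤ.+-identityˡ _) (ℤ.*-identityʳ _))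
                ; (suc k) → sym (trans (cong (λ c → v k ℤ.+ c) (ℤ.*-zeroʳ (ℤ.+ m))) (ℤ.+-identityʳ (v k))) })
    (period P zero (ℤ.+ 0 ∷ v))
boxΣ-shift⁺ {suc n} {m} {F} P (suc i) = sum-cong-≗ {m} λ a → trans
  (boxΣ-cong m n λ v → cong-≗ P ((ℤ.+ toℕ a ∷ v) ⊹ ν (suc i) true) (ℤ.+ toℕ a ∷ (v ⊹ ν i true))
    λ { zero → ℤ.+-identityʳ _ ; (suc k) → refl })
  (boxΣ-shift⁺ (slice (ℤ.+ toℕ a)) i)
  where
  slice : ∀ a → Periodic m (λ v → F (a ∷ v))
  slice a .cong-≗ z w z≗w = cong-≗ P _ _ λ { zero → refl ; (suc k) → z≗w k }
  slice a .period j z = trans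
    (cong-≗ P _ _ λ { zero    → sym (trans (cong (λ c → a ℤ.+ c) (ℤ.*-zeroʳ (ℤ.+ m))) (ℤ.+-identityʳ a))
                ; (suc k) → refl })
    (period P (suc j) (a ∷ z))

boxΣ-shift : ∀ {m} {F : Point n → ℕ} → Periodic m F → ∀ i b →
             boxΣ m n (λ z → F (z ⊹ ν i b)) ≡ boxΣ m n F
boxΣ-shift P i true = boxΣ-shift⁺ P i
-- A forward shift of the backward-shifted function restores `F`.
boxΣ-shift {n} {m} {F} P i false = trans (sym (boxΣ-shift⁺ shifted i))
  (boxΣ-cong m n λ z → cong-≗ P _ _ (cancel z i true))
  where
  shifted : Periodic m (λ z → F (z ⊹ ν i false))
  shifted .cong-≗ z w z≗w = cong-≗ P _ _ (⊹-congˡ (ν i false) z≗w)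
  shifted .period j z = trans
    (cong-≗ P _ _ λ k → solve 3 (λ z u v → z :+ u :+ v := z :+ v :+ u) refl
                      (z k) (ℤ.+ m ℤ.* ν j true k) (ν i false k))
    (period P j (z ⊹ ν i false))

-- Double counting on the torus of side 12

module Density {S : Point n → Set} (D : Dominating S) (2∣n : 2 ∣ n) where
  open Dominating D
  open Corners D

  χ-periodic : Periodic 12 χ
  χ-periodic .cong-≗ z w z≗w = χ-cong (resp z≗w) (resp (sym ∘ z≗w))
  χ-periodic .period i z = χ-cong (resp back ∘ periodic 2∣n i false) (periodic 2∣n i true)
    where
    back : ∀ k → z k ℤ.+ ℤ.+ 12 ℤ.* ν i true k ℤ.+ ℤ.+ 12 ℤ.* ν i false k ≡ z k
    back k rewrite ν-not i true k =
      solve 2 (λ z x → z :+ con (ℤ.+ 12) :* x :+ con (ℤ.+ 12) :* :- x := z) refl (z k) (ν i true k)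

  private
    axis-sum : Point n → Fin n → ℕ
    axis-sum z i = χ (z ⊹ ν i true) + χ (z ⊹ ν i false)

  axis-sum≡1 : ∀ z i b → S (z ⊹ ν i b) → ¬ S (z ⊹ ν i (not b)) → axis-sum z i ≡ 1
  axis-sum≡1 z i true  p q = cong₂ _+_ (χ-∈ p) (χ-∉ q)
  axis-sum≡1 z i false p q = cong₂ _+_ (χ-∉ q) (χ-∈ p)

  -- A cell has n neighbours in `S` if it lies in `S`, and one otherwise. Adding `χ z` on the left
  -- avoids the coefficient n - 1.
  neighbours : ∀ z → sum (axis-sum z) + χ z ≡ 1 + n * χ z
  neighbours z with S? z
  ... | yes z∈S = trans (ℕ.+-comm _ 1) (cong suc (trans (sum-cong-≗ one) (sum-const n 1)))
    where
    one : ∀ i → axis-sum z i ≡ 1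
    one i with b , p , q ← paired z i z∈S = axis-sum≡1 z i b p q
  ... | no z∉S with i , b , h ← dominated z z∉S = trans (ℕ.+-identityʳ _)
        (trans (sum-single _ i λ j j≢i → cong₂ _+_ (χ-∉ (j≢i ∘ other)) (χ-∉ (j≢i ∘ other)))
        (trans (axis-sum≡1 z i b h λ q → Bool.not-¬ refl (proj₂ (once z z∉S h q)))
               (cong suc (sym (ℕ.*-zeroʳ n)))))
    where
    other : ∀ {j a} → S (z ⊹ ν j a) → j ≡ i
    other p = once-axis z z∉S p h

  -- Sum `neighbours` over the box: each of the 2n shifts of `χ` contributes N, whence 2nN + N =
  -- 12^n + nN.
  density : suc n * boxΣ 12 n χ ≡ 12 ^ n
  density = ℕ.+-cancelʳ-≡ (n * N) _ _ (begin
    suc n * N + n * N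
      ≡⟨ ℕ-Solver.solve 2 (λ n N → (con′ 1 :+′ n) :*′ N :+′ n :*′ N :=′ n :*′ (N :+′ N) :+′ N) refl n N ⟩
    n * (N + N) + N
      ≡⟨ cong (_+ N) (sum-const n (N + N)) ⟨
    sum (λ (i : Fin n) → N + N) + N
      ≡⟨ cong (_+ N) (sum-cong-≗ {n} λ i → trans (boxΣ-+ 12 n _ _)
           (cong₂ _+_ (boxΣ-shift χ-periodic i true) (boxΣ-shift χ-periodic i false))) ⟨
    sum (λ i → boxΣ 12 n λ z → axis-sum z i) + N
      ≡⟨ cong (_+ N) (boxΣ-sum 12 n n _) ⟨
    boxΣ 12 n (λ z → sum (axis-sum z)) + N
      ≡⟨ boxΣ-+ 12 n _ _ ⟨
    boxΣ 12 n (λ z → sum (axis-sum z) + χ z)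
      ≡⟨ boxΣ-cong 12 n neighbours ⟩
    boxΣ 12 n (λ z → 1 + n * χ z)
      ≡⟨ boxΣ-+ 12 n (λ _ → 1) _ ⟩
    boxΣ 12 n (λ _ → 1) + boxΣ 12 n (λ z → n * χ z)
      ≡⟨ cong₂ _+_ (boxΣ-1 12 n) (trans (boxΣ-cong 12 n λ z → sym (sum-const n (χ z)))
           (trans (boxΣ-sum 12 n n λ _ → χ) (sum-const n N))) ⟩
    12 ^ n + n * N ∎)
    where
    open ≡-Reasoning
    open ℕ-Solver using () renaming (_:+_ to _:+′_; _:=_ to _:=′_; _:*_ to _:*′_; con to con′)
    N = boxΣ 12 n χ

-- Points at distance at most one

IsBit : ℤ → Set
IsBit a = a ≡ -[1+ 0 ] ⊎ a ≡ ℤ.+ 0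

isBit? : ∀ a → Dec (IsBit a)
isBit? a = (a ℤ.≟ -[1+ 0 ]) ⊎-dec (a ℤ.≟ ℤ.+ 0)

bits-close : ∀ b {r} → IsBit r → ¬ IsBit (r ℤ.- sgn b ℤ.- sgn b)
bits-close true  (inj₁ refl) = λ { (inj₁ ()) ; (inj₂ ()) }
bits-close true  (inj₂ refl) = λ { (inj₁ ()) ; (inj₂ ()) }
bits-close false (inj₁ refl) = λ { (inj₁ ()) ; (inj₂ ()) }
bits-close false (inj₂ refl) = λ { (inj₁ ()) ; (inj₂ ()) }

dist₁-≗ : ∀ {p q : Point n} → p ≗ q → dist₁ p q ≡ 0
dist₁-≗ {zero}  p≗q = refl
dist₁-≗ {suc n} p≗q = cong₂ _+_ (cong ℤ.∣_∣ (ℤ.i≡j⇒i-j≡0 (p≗q zero))) (dist₁-≗ (p≗q ∘ suc))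

dist₁-ν : ∀ {p q : Point n} i b → p ≗ q ⊹ ν i b → dist₁ p q ≡ 1
dist₁-ν {suc n} {p} {q} zero b p≗ rewrite p≗ zero = cong₂ _+_
  (trans (cong ℤ.∣_∣ (solve 2 (λ q u → q :+ u :+ :- q := u) refl (q zero) (sgn b))) (∣sgn∣ b))
  (dist₁-≗ λ k → trans (p≗ (suc k)) (ℤ.+-identityʳ _))
  where
  ∣sgn∣ : ∀ b → ℤ.∣ sgn b ∣ ≡ 1
  ∣sgn∣ true  = refl
  ∣sgn∣ false = refl
dist₁-ν {suc n} {p} {q} (suc i) b p≗ = cong₂ _+_
  (cong ℤ.∣_∣ (ℤ.i≡j⇒i-j≡0 (trans (p≗ zero) (ℤ.+-identityʳ _)))) (dist₁-ν i b (p≗ ∘ suc))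

dist₁≤0 : ∀ (p q : Point n) → dist₁ p q ≤ 0 → p ≗ q
dist₁≤0 {suc n} p q d≤0 zero = ℤ.i-j≡0⇒i≡j _ _
  (ℤ.∣i∣≡0⇒i≡0 {p zero ℤ.- q zero} (ℕ.n≤0⇒n≡0 (ℕ.m+n≤o⇒m≤o ℤ.∣ p zero ℤ.- q zero ∣ d≤0)))
dist₁≤0 {suc n} p q d≤0 (suc k) = dist₁≤0 (p ∘ suc) (q ∘ suc) (ℕ.m+n≤o⇒n≤o ℤ.∣ p zero ℤ.- q zero ∣ d≤0) k

-- Either the first coordinates differ by a unit, which uses up the whole distance, or they agree
-- and the remaining coordinates decide.
dist₁≤1 : ∀ (p q : Point n) → dist₁ p q ≤ 1 → p ≗ q ⊎ ∃₂ λ i b → p ≗ q ⊹ ν i b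
dist₁≤1 {zero}  p q d≤1 = inj₁ λ ()
dist₁≤1 {suc n} p q d≤1 = split (p zero ℤ.- q zero) refl d≤1
  where
  Goal = p ≗ q ⊎ ∃₂ λ i b → p ≗ q ⊹ ν i b
  unit : ∀ b → p zero ℤ.- q zero ≡ sgn b → dist₁ (p ∘ suc) (q ∘ suc) ≤ 0 → Goal
  unit b e tail≤0 = inj₂ (zero , b , λ
    { zero    → trans (solve 2 (λ p q → p := q :+ (p :+ :- q)) refl (p zero) (q zero)) (cong (λ c → q zero ℤ.+ c) e)
    ; (suc k) → trans (dist₁≤0 (p ∘ suc) (q ∘ suc) tail≤0 k) (sym (ℤ.+-identityʳ _)) })
  split : ∀ a → p zero ℤ.- q zero ≡ a → ℤ.∣ a ∣ + dist₁ (p ∘ suc) (q ∘ suc) ≤ 1 → Goal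
  split (ℤ.+ 1)       e (s≤s h) = unit true e h
  split -[1+ 0 ]      e (s≤s h) = unit false e h
  split (ℤ.+ suc (suc a)) e (s≤s ())
  split -[1+ suc a ]  e (s≤s ())
  split (ℤ.+ 0)       e h with p₀≡q₀ ← ℤ.i-j≡0⇒i≡j (p zero) (q zero) e | dist₁≤1 (p ∘ suc) (q ∘ suc) h
  ... | inj₁ p≗q           = inj₁ λ { zero → p₀≡q₀ ; (suc k) → p≗q k }
  ... | inj₂ (i , b , p≗q) = inj₂ (suc i , b , λ
          { zero → trans p₀≡q₀ (sym (ℤ.+-identityʳ _)) ; (suc k) → p≗q k })

-- The union of the cubes of a tiling

module Tiling {T : Point n → Set} (tiling : IsTiling n T) where

  Body : Point n → Set
  Body z = Σ (Point n) λ x → T x × IsBinaryNeg (λ i → z i ℤ.- x i)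

  private
    slide : ∀ z u (x : Point n) k → (z ⊹ u) k ℤ.- x k ≡ z k ℤ.- x k ℤ.+ u k
    slide z u x k = solve 3 (λ z u x → z :+ u :+ :- x := z :+ :- x :+ u) refl (z k) (u k) (x k)

  same-tile : ∀ z {x y} → T x → T y → InTranslate {n} x z → InTranslate {n} y z → x ≗ y
  same-tile z {x} {y} x∈T y∈T = proj₂ tiling z x y x∈T y∈T

  within : ∀ (x z : Point n) → IsBinaryNeg (λ i → z i ℤ.- x i) → InTranslate x z
  within x z bin = _ , bin , ℕ.≤-trans (ℕ.≤-reflexive (dist₁-≗ {p = λ i → z i ℤ.- x i} λ _ → refl)) z≤n

  beside : ∀ (x z : Point n) i b → IsBinaryNeg (λ k → (z ⊹ ν i b) k ℤ.- x k) → InTranslate x z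
  beside x z i b bin = _ , bin , ℕ.≤-reflexive (dist₁-ν i b (slide z (ν i b) x))

  -- By disjointness the two cells would lie in the same cube, which has side two.
  opposite : ∀ z i b → Body (z ⊹ ν i b) → ¬ Body (z ⊹ ν i (not b))
  opposite z i b (x , x∈T , binx) (y , y∈T , biny) =
    bits-close b (binx i) (subst IsBit two-apart (biny i))
    where
    two-apart : (z ⊹ ν i (not b)) i ℤ.- y i ≡ (z ⊹ ν i b) i ℤ.- x i ℤ.- sgn b ℤ.- sgn b
    two-apart rewrite same-tile z y∈T x∈T (beside y z i (not b) biny) (beside x z i b binx) i
                    | ν-not i b i | updateAt-updates i {λ _ → sgn b} (replicate n 0ℤ) =
      solve 3 (λ z x u → z :+ :- u :+ :- x := z :+ u :+ :- x :+ :- u :+ :- u) refl (z i) (x i) (sgn b)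

  off-axis : ∀ z (x : Point n) i b {k} → k ≢ i → (z ⊹ ν i b) k ℤ.- x k ≡ z k ℤ.- x k
  off-axis z x i b {k} k≢i = trans (slide z (ν i b) x k)
    (trans (cong (λ c → z k ℤ.- x k ℤ.+ c) (updateAt-minimal k i (replicate n 0ℤ) k≢i)) (ℤ.+-identityʳ _))

  on-axis : ∀ z (x : Point n) i b → (z ⊹ ν i b) i ℤ.- x i ≡ z i ℤ.- x i ℤ.+ sgn b
  on-axis z x i b = trans (slide z (ν i b) x i)
    (cong (λ c → z i ℤ.- x i ℤ.+ c) (updateAt-updates i (replicate n 0ℤ)))

  body-dominating : Dominating Body
  body-dominating .Dominating.resp z≗w (x , x∈T , bin) =
    x , x∈T , λ k → subst (λ c → IsBit (c ℤ.- x k)) (z≗w k) (bin k)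
  body-dominating .Dominating.S? z with x , x∈T , covers ← proj₁ tiling z
    with Fin.all? (λ k → isBit? (z k ℤ.- x k))
  ... | yes bin = yes (x , x∈T , bin)
  -- Any cube containing z belongs to the tile covering z, so testing that one tile suffices.
  ... | no ¬bin = no λ { (y , y∈T , bin) → ¬bin λ k →
          subst (λ c → IsBit (z k ℤ.- c)) (same-tile z y∈T x∈T (within y z bin) covers k) (bin k) }
  body-dominating .Dominating.dominated z z∉B with x , x∈T , p , bin , near ← proj₁ tiling z
    with dist₁≤1 p (λ k → z k ℤ.- x k) near
  ... | inj₁ p≗           = contradiction (x , x∈T , λ k → subst IsBit (p≗ k) (bin k)) z∉B
  ... | inj₂ (i , b , p≗) = i , b , x , x∈T , λ k →
          subst IsBit (trans (p≗ k) (sym (slide z (ν i b) x k))) (bin k)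
  body-dominating .Dominating.once z {i} {j} {a} {b} z∉B p@(x , x∈T , binx) q@(y , y∈T , biny)
    with i ≟ j | b Bool.≟ a
  ... | yes refl | yes refl = refl , refl
  ... | yes refl | no b≢a   =
        contradiction (subst (λ b → Body (z ⊹ ν i b)) (Bool.¬-not b≢a) q) (opposite z i a p)
  -- Both neighbours lie in the cube of one tile. Every coordinate of z is shared with at least one
  -- of them, so z would lie in that cube too.
  ... | no i≢j   | _        = contradiction (x , x∈T , bin) z∉B
    where
    bin : ∀ k → IsBit (z k ℤ.- x k)
    bin k with k ≟ i
    ... | no k≢i   = subst IsBit (off-axis z x i a k≢i) (binx k)
    ... | yes refl rewrite same-tile z x∈T y∈T (beside x z i a binx) (beside y z j b biny) k =
          subst IsBit (off-axis z y j b i≢j) (biny k)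
  body-dominating .Dominating.paired z i (x , x∈T , bin) = step (bin i)
    where
    moved : ∀ b → IsBit (z i ℤ.- x i ℤ.+ sgn b) → Body (z ⊹ ν i b)
    moved b bit = x , x∈T , λ k → moved-bin k (k ≟ i)
      where
      moved-bin : ∀ k → Dec (k ≡ i) → IsBit ((z ⊹ ν i b) k ℤ.- x k)
      moved-bin k (yes refl) = subst IsBit (sym (on-axis z x i b)) bit
      moved-bin k (no k≢i)   = subst IsBit (sym (off-axis z x i b k≢i)) (bin k)
    step : IsBit (z i ℤ.- x i) → ∃ λ b → Body (z ⊹ ν i b) × ¬ Body (z ⊹ ν i (not b))
    step (inj₁ e) = true  , h , opposite z i true h
      where h = moved true (inj₂ (cong (λ c → c ℤ.+ 1ℤ) e))
    step (inj₂ e) = false , h , opposite z i false h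
      where h = moved false (inj₁ (cong (λ c → c ℤ.+ -1ℤ) e))

-- Odd divisors of powers of 12

irreducible-coprime : ∀ {m p} → Irreducible p → ¬ p ∣ m → Coprime m p
irreducible-coprime irr p∤m (d∣m , d∣p) with irr d∣p
... | inj₁ d≡1  = d≡1
... | inj₂ refl = contradiction d∣m p∤m

irreducible[3] : Irreducible 3
irreducible[3] = prime⇒irreducible (from-yes (prime? 3))

odd-divisor-12* : ∀ {m} c → ¬ 2 ∣ m → m ∣ 12 * c → m ∣ 3 * c
odd-divisor-12* {m} c odd m∣12c = coprime-divisor coprime (coprime-divisor coprime (subst (m ∣_)
    (trans (ℕ.*-assoc 2 6 c) (cong (2 *_) (ℕ.*-assoc 2 3 c))) m∣12c))
  where
  coprime = irreducible-coprime irreducible[2] odd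

divisor-3* : ∀ m c → m ∣ 3 * c → m ∣ c ⊎ ∃ λ q → m ≡ 3 * q × q ∣ c
divisor-3* m c m∣3c with 3 ∣? m
... | no 3∤m             = inj₁ (coprime-divisor (irreducible-coprime irreducible[3] 3∤m) m∣3c)
... | yes (divides q eq) = inj₂ (q , m≡3q , *-cancelˡ-∣ 3 (subst (_∣ 3 * c) m≡3q m∣3c))
  where
  m≡3q = trans eq (ℕ.*-comm q 3)

-- Remove one factor 12 at a time: its two factors 2 are coprime to m, and its factor 3 either is
-- coprime to m or cancels against a factor 3 of m.
odd-divisor-12^ : ∀ m a → ¬ 2 ∣ m → m ∣ 12 ^ a → ∃ λ t → m ≡ 3 ^ t
odd-divisor-12^ m zero    odd m∣1 = 0 , ∣1⇒≡1 m∣1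
odd-divisor-12^ m (suc a) odd m∣12^1+a with divisor-3* m (12 ^ a) (odd-divisor-12* (12 ^ a) odd m∣12^1+a)
... | inj₁ m∣12^a             = odd-divisor-12^ m a odd m∣12^a
... | inj₂ (q , m≡3q , q∣12^a)
    with t , q≡3^t ← odd-divisor-12^ q a (λ 2∣q → odd (subst (2 ∣_) (sym m≡3q) (∣n⇒∣m*n 3 2∣q))) q∣12^a
    = suc t , trans m≡3q (cong (3 *_) q≡3^t)

theorem5 : (n : ℕ) → 0 < n → (T : Point n → Set) → IsTiling n T →
    Σ ℕ (λ k → n ≡ 2 * k) →
    Σ ℕ (λ t → (0 < t) × (n ≡ 3 ^ t ∸ 1))
theorem5 n 0<n T tiling (k , n≡2k) = exponent (odd-divisor-12^ (suc n) n 2∤1+n 1+n∣12^n)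
  where
  open Tiling tiling
  2∣n : 2 ∣ n
  2∣n = divides k (trans n≡2k (ℕ.*-comm 2 k))
  2∤1+n : ¬ 2 ∣ suc n
  2∤1+n 2∣1+n = contradiction
    (∣1⇒≡1 (∣m+n∣m⇒∣n (subst (2 ∣_) (ℕ.+-comm 1 n) 2∣1+n) 2∣n)) λ ()
  1+n∣12^n : suc n ∣ 12 ^ n
  1+n∣12^n = subst (suc n ∣_) (Density.density body-dominating 2∣n) (m∣m*n _)
  exponent : (∃ λ t → suc n ≡ 3 ^ t) → Σ ℕ (λ t → (0 < t) × (n ≡ 3 ^ t ∸ 1))
  -- The exponent 0 would force n = 0.
  exponent (zero  , 1+n≡1)   = contradiction (ℕ.suc-injective 1+n≡1) (ℕ.>⇒≢ 0<n)
  exponent (suc t , 1+n≡3^t) = suc t , s≤s z≤n , cong (_∸ 1) 1+n≡3^t
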